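{- For every integer $\ell\ge 1$, the comb full binary tree $C_\ell$, which has $n=2\ell+1$ vertices, admits a graceful labeling $f$ such that, for some longest root-to-leaf path $u_0u_1\cdots u_d$ of $C_\ell$ (with $u_0$ the root and $d$ its number of edges), the restriction of $f$ to that path is the alternating extreme spine assignment, i.e. for $0\le i\le d$, $$f(u_i)=\begin{cases} i/2, & i\text{ even},\\ n-1-(i-1)/2, & i\text{ odd}.\end{cases}$$
   Context: A graceful labeling of a tree $T$ with $n$ vertices is a bijection $f:V(T)\to\{0,1,\dots,n-1\}$ such that the set of induced edge labels $\{|f(u)-f(v)|: uv\in E(T)\}$ equals $\{1,2,\dots,n-1\}$. A full binary tree is a rooted tree in which every non-leaf vertex has exactly two children. Path length is the number of edges. For $\ell\ge1$, the comb $C_\ell$ is the rooted full binary tree with root $v_0$, internal vertices $v_0,v_1,\dots,v_{\ell-1}$ and leaves $w_0,w_1,\dots,w_{\ell-1},v_\ell$, where for $0\le i\le \ell-1$ the two children of $v_i$ are $v_{i+1}$ and $w_i$. -}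

module Defs where

open import Data.Bool using (if_then_else_)
open import Data.Nat using (ℕ; zero; suc; _+_; _*_; _∸_; _/_; _≤_; ∣_-_∣)
open import Data.Nat.Divisibility using (_∣?_)
open import Data.Fin using (Fin; zero; suc; toℕ; fromℕ; inject₁)
open import Data.Fin.Properties using (+↔⊎; inject₁-injective)
open import Data.Product using (∃₂; ∃-syntax; _×_; _,_)
open import Data.Sum using (_⊎_; inj₁; inj₂)
open import Data.Empty using (⊥-elim)
open import Function using (_⇔_; _↔_; mk↔ₛ′)
open import Function.Definitions using (Injective; Bijective)
open import Function.Construct.Composition using (_↔-∘_)
open import Function.Construct.Symmetry using (↔-sym)
open import Relation.Nullary using (¬_; does)
open import Relation.Binary.PropositionalEquality using (_≡_; _≢_; refl; cong)
open import Relation.Binary.Construct.Closure.ReflexiveTransitive using (Star; ε; _◅_; _◅◅_)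

-- A finite rooted tree, presented by its child relation: x ⟶ y means that y is
-- a child of x.
record RootedTree : Set₁ where
  field
    V             : Set
    root          : V
    _⟶_           : V → V → Set
    root-orphan   : ∀ {x} → ¬ (x ⟶ root)
    parent-unique : ∀ {x y z} → x ⟶ z → y ⟶ z → x ≡ y
    reachable     : ∀ x → Star _⟶_ root x
    order         : ℕ
    finite        : V ↔ Fin order

module _ (T : RootedTree) where
  open RootedTree T

  Adjacent : V → V → Set
  Adjacent x y = x ⟶ y ⊎ y ⟶ x

  Leaf : V → Set
  Leaf x = ¬ (∃[ y ] x ⟶ y)

  FullBinary : Set
  FullBinary = ∀ x → ¬ Leaf x →
    ∃₂ λ a b → a ≢ b × x ⟶ a × x ⟶ b × (∀ c → x ⟶ c → c ≡ a ⊎ c ≡ b)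

  record IsGraceful (f : V → Fin order) : Set where
    field
      bijective   : Bijective _≡_ _≡_ f
      edge-labels : ∀ k →
        (∃₂ λ x y → Adjacent x y × ∣ toℕ (f x) - toℕ (f y) ∣ ≡ k)
          ⇔ (1 ≤ k × k ≤ order ∸ 1)

  -- Simple paths of the underlying undirected graph; d counts edges.
  record IsRootToLeafPath (d : ℕ) (u : Fin (suc d) → V) : Set where
    field
      starts   : u zero ≡ root
      ends     : Leaf (u (fromℕ d))
      step     : ∀ (i : Fin d) → Adjacent (u (inject₁ i)) (u (suc i))
      distinct : Injective _≡_ _≡_ u

  IsLongestRootToLeafPath : (d : ℕ) → (Fin (suc d) → V) → Set
  IsLongestRootToLeafPath d u =
    IsRootToLeafPath d u × (∀ e u′ → IsRootToLeafPath e u′ → e ≤ d)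

-- For i < n, as on a path of a tree of order n, no subtraction in the branch
-- that is taken is truncated.
alternatingExtreme : ℕ → ℕ → ℕ
alternatingExtreme n i =
  if does (2 ∣? i) then i / 2 else n ∸ 1 ∸ (i ∸ 1) / 2

data CombVertex (ℓ : ℕ) : Set where
  v : Fin (suc ℓ) → CombVertex ℓ
  w : Fin ℓ → CombVertex ℓ

data CombChild {ℓ : ℕ} : CombVertex ℓ → CombVertex ℓ → Set where
  spine : (i : Fin ℓ) → CombChild (v (inject₁ i)) (v (suc i))
  tooth : (i : Fin ℓ) → CombChild (v (inject₁ i)) (w i)

private
  orphan : ∀ {ℓ} {x : CombVertex ℓ} → ¬ CombChild x (v zero)
  orphan ()

  unique-parent : ∀ {ℓ} {x y z : CombVertex ℓ} →
                  CombChild x z → CombChild y z → x ≡ y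
  unique-parent (spine i) (spine .i) = refl
  unique-parent (tooth i) (tooth .i) = refl

  shift : ∀ {ℓ} → CombVertex ℓ → CombVertex (suc ℓ)
  shift (v i) = v (suc i)
  shift (w i) = w (suc i)

  shift-child : ∀ {ℓ} {x y : CombVertex ℓ} →
                CombChild x y → CombChild (shift x) (shift y)
  shift-child (spine i) = spine (suc i)
  shift-child (tooth i) = tooth (suc i)

  shift-star : ∀ {ℓ} {x y : CombVertex ℓ} →
               Star CombChild x y → Star CombChild (shift x) (shift y)
  shift-star ε        = ε
  shift-star (c ◅ cs) = shift-child c ◅ shift-star cs

  reach : ∀ {ℓ} (x : CombVertex ℓ) → Star CombChild (v zero) x
  reach         (v zero)    = ε
  reach {suc ℓ} (v (suc i)) = spine zero ◅ shift-star (reach (v i))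
  reach         (w zero)    = tooth zero ◅ ε
  reach {suc ℓ} (w (suc i)) = spine zero ◅ shift-star (reach (w i))

  vertex↔⊎ : ∀ {ℓ} → CombVertex ℓ ↔ (Fin (suc ℓ) ⊎ Fin ℓ)
  vertex↔⊎ = mk↔ₛ′ to from
    (λ { (inj₁ _) → refl ; (inj₂ _) → refl })
    (λ { (v _) → refl ; (w _) → refl })
    where
    to : ∀ {ℓ} → CombVertex ℓ → Fin (suc ℓ) ⊎ Fin ℓ
    to (v i) = inj₁ i
    to (w i) = inj₂ i
    from : ∀ {ℓ} → Fin (suc ℓ) ⊎ Fin ℓ → CombVertex ℓ
    from (inj₁ i) = v i
    from (inj₂ i) = w i

-- comb 0, which the definition also allows, is a single vertex.
comb : ℕ → RootedTree
comb ℓ = record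
  { V             = CombVertex ℓ
  ; root          = v zero
  ; _⟶_           = CombChild
  ; root-orphan   = orphan
  ; parent-unique = unique-parent
  ; reachable     = reach
  ; order         = suc ℓ + ℓ
  ; finite        = ↔-sym +↔⊎ ↔-∘ vertex↔⊎
  }

private
  last-or-inject : ∀ {ℓ} (i : Fin (suc ℓ)) →
                   i ≡ fromℕ ℓ ⊎ (∃[ j ] i ≡ inject₁ j)
  last-or-inject {zero}  zero    = inj₁ refl
  last-or-inject {suc ℓ} zero    = inj₂ (zero , refl)
  last-or-inject {suc ℓ} (suc i) with last-or-inject i
  ... | inj₁ e       = inj₁ (cong suc e)
  ... | inj₂ (j , e) = inj₂ (suc j , cong suc e)

  fromℕ≢inject₁ : ∀ {ℓ} (j : Fin ℓ) → fromℕ ℓ ≢ inject₁ j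
  fromℕ≢inject₁ zero    ()
  fromℕ≢inject₁ (suc j) e = fromℕ≢inject₁ j (suc-inj e)
    where
    suc-inj : ∀ {n} {a b : Fin n} → Fin.suc a ≡ suc b → a ≡ b
    suc-inj refl = refl

  child-of-v : ∀ {ℓ} {i : Fin (suc ℓ)} {y} → CombChild (v i) y →
               ∃[ j ] i ≡ inject₁ j × (y ≡ v (suc j) ⊎ y ≡ w j)
  child-of-v (spine j) = j , refl , inj₁ refl
  child-of-v (tooth j) = j , refl , inj₂ refl

comb-leaf-v : ∀ ℓ → Leaf (comb ℓ) (v (fromℕ ℓ))
comb-leaf-v ℓ (_ , c) with child-of-v c
... | j , e , _ = fromℕ≢inject₁ j e

comb-leaf-w : ∀ ℓ (i : Fin ℓ) → Leaf (comb ℓ) (w i)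
comb-leaf-w ℓ i (_ , ())

comb-fullBinary : ∀ ℓ → FullBinary (comb ℓ)
comb-fullBinary ℓ (w i) ¬leaf = ⊥-elim (¬leaf (comb-leaf-w ℓ i))
comb-fullBinary ℓ (v i) ¬leaf with last-or-inject i
... | inj₁ refl       = ⊥-elim (¬leaf (comb-leaf-v ℓ))
... | inj₂ (j , refl) =
  v (suc j) , w j , (λ ()) , spine j , tooth j , children
  where
  children : ∀ c → CombChild (v (inject₁ j)) c → c ≡ v (suc j) ⊎ c ≡ w j
  children c p with child-of-v p
  ... | k , e , q with inject₁-injective e
  ... | refl = q

{-# OPTIONS --safe #-}
module Submission where

-- Let n = 2ℓ + 1 and let zigzag be the sequence 0, n-1, 1, n-2, 2, …, ℓ of all
-- labels.  Its i-th step has length n-1-i, and terms at distance 2k in it differ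
-- by k.  Label v_i by term i and w_i by term 2ℓ-i: the spine edges then carry
-- 2ℓ, …, ℓ+1 and the teeth, at distance 2(ℓ-i), carry ℓ, …, 1.

open import Data.Nat using (ℕ; zero; suc; _+_; _*_; _∸_; _≤_; _<_; z≤n; s≤s; ∣_-_∣)
open import Data.Nat.Properties
open import Data.Nat.Divisibility using (_∣_; _∤_; _∣?_; n∣m*n; ∣m+n∣m⇒∣n; >⇒∤)
open import Data.Nat.DivMod using (m*n/n≡m)
open import Data.Nat.Tactic.RingSolver using (solve-∀)
open import Data.Fin using (Fin; zero; suc; toℕ; fromℕ; fromℕ<; inject₁; opposite; _↑ˡ_)
import Data.Fin.Properties as Finₚ
open import Data.Fin.Properties
  using (toℕ-fromℕ; toℕ-fromℕ<; toℕ-inject₁; toℕ-↑ˡ; toℕ-↑ʳ; toℕ<n; toℕ≤pred[n]; opposite-prop;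
         opposite-suc; opposite-involutive; toℕ-injective)
open import Data.Fin.Induction using (<-weakInduction)
open import Data.Product using (Σ-syntax; ∃-syntax; ∃₂; _×_; _,_)
open import Data.Sum using (_⊎_; inj₁; inj₂)
open import Function using (_↔_; mk↔ₛ′; mk⇔)
open import Function.Bundles using (module Inverse; module Bijection)
open import Function.Construct.Composition using (_↔-∘_)
open import Function.Properties.Inverse using (↔⇒⤖)
open import Relation.Nullary using (contradiction; yes; no)
open import Relation.Nullary.Decidable using (dec-true; dec-false)
open import Relation.Binary.PropositionalEquality
  using (_≡_; _≢_; refl; sym; trans; cong; cong₂; subst; subst₂; module ≡-Reasoning)
open import Defs

-- Reflections of `Fin` and the zigzag sequence.

∣o∸m-o∸n∣≡∣m-n∣ : ∀ {m n o} → m ≤ o → n ≤ o → ∣ o ∸ m - o ∸ n ∣ ≡ ∣ m - n ∣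
∣o∸m-o∸n∣≡∣m-n∣ {zero} {n} {o} _ n≤o =
  trans (m≤n⇒∣n-m∣≡n∸m (m∸n≤m o n)) (m∸[m∸n]≡n n≤o)
∣o∸m-o∸n∣≡∣m-n∣ {suc m} {zero} {o} m<o _ =
  trans (m≤n⇒∣m-n∣≡n∸m (m∸n≤m o (suc m))) (m∸[m∸n]≡n m<o)
∣o∸m-o∸n∣≡∣m-n∣ {suc m} {suc n} (s≤s m≤o) (s≤s n≤o) = ∣o∸m-o∸n∣≡∣m-n∣ m≤o n≤o

opposite-isometry : ∀ {n} (i j : Fin n) →
  ∣ toℕ (opposite i) - toℕ (opposite j) ∣ ≡ ∣ toℕ i - toℕ j ∣
opposite-isometry i j = trans
  (cong₂ ∣_-_∣ (opposite-prop i) (opposite-prop j))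
  -- `opposite` subtracts the successors of both indices from n; these successors cancel by
  -- computation inside the absolute difference.
  (∣o∸m-o∸n∣≡∣m-n∣ (toℕ<n i) (toℕ<n j))

opposite-+ : ∀ {n} (i : Fin n) → toℕ (opposite i) + suc (toℕ i) ≡ n
opposite-+ i = trans (cong (_+ suc (toℕ i)) (opposite-prop i)) (m∸n+n≡m (toℕ<n i))

-- Removing the leading 0 from the zigzag on n + 1 labels leaves the reflected
-- zigzag on the other n.
zigzag : ∀ {n} → Fin n → Fin n
zigzag zero    = zero
zigzag (suc i) = suc (opposite (zigzag i))

-- The argument `opposite i` is not structurally smaller than `suc i`; the recursion terminates
-- because the implicit size drops.
unzigzag : ∀ {n} → Fin n → Fin n
unzigzag zero            = zero
unzigzag {suc n} (suc i) = suc (unzigzag (opposite i))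

zigzag-unzigzag : ∀ {n} (i : Fin n) → zigzag (unzigzag i) ≡ i
zigzag-unzigzag zero = refl
zigzag-unzigzag {suc n} (suc i) = cong suc
  (trans (cong opposite (zigzag-unzigzag (opposite i))) (opposite-involutive i))

unzigzag-zigzag : ∀ {n} (i : Fin n) → unzigzag (zigzag i) ≡ i
unzigzag-zigzag zero = refl
unzigzag-zigzag (suc i) = cong suc
  (trans (cong unzigzag (opposite-involutive (zigzag i))) (unzigzag-zigzag i))

zigzag-↔ : ∀ {n} → Fin n ↔ Fin n
zigzag-↔ = mk↔ₛ′ zigzag unzigzag zigzag-unzigzag unzigzag-zigzag

-- The first step jumps from 0 to the top label n. Later steps belong to the reflected zigzag on one
-- label fewer, and reflection preserves their lengths. The additive form avoids truncated
-- subtraction.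
zigzag-step : ∀ {n} (i : Fin n) →
  ∣ toℕ (zigzag (inject₁ i)) - toℕ (zigzag (suc i)) ∣ + toℕ i ≡ n
zigzag-step {suc m} zero = trans (+-identityʳ _) (cong suc (toℕ-fromℕ m))
zigzag-step (suc i) = trans (+-suc _ (toℕ i)) (cong suc (trans
  (cong (_+ toℕ i) (opposite-isometry (zigzag (inject₁ i)) (zigzag (suc i))))
  (zigzag-step i)))

-- Two unfoldings reflect twice. The reflections cancel up to a shift by one, so each pair of steps
-- raises the term by 1.
zigzag-even : ∀ {n} k (i : Fin n) → toℕ i ≡ k * 2 → toℕ (zigzag i) ≡ k
zigzag-even zero    zero          _ = refl
zigzag-even (suc k) (suc (suc i)) e = cong suc (begin
  toℕ (opposite (suc (opposite (zigzag i)))) ≡⟨ opposite-suc (opposite (zigzag i)) ⟩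
  toℕ (opposite (opposite (zigzag i)))       ≡⟨ cong toℕ (opposite-involutive (zigzag i)) ⟩
  toℕ (zigzag i)                             ≡⟨ zigzag-even k i (suc-injective (suc-injective e)) ⟩
  k                                          ∎)
  where open ≡-Reasoning

zigzag-odd : ∀ {n} k (i : Fin n) → toℕ i ≡ suc (k * 2) → toℕ (zigzag i) ≡ n ∸ 1 ∸ k
zigzag-odd {suc n} k (suc i) e = begin
  suc (toℕ (opposite (zigzag i))) ≡⟨ cong suc (opposite-prop (zigzag i)) ⟩
  suc (n ∸ suc (toℕ (zigzag i)))  ≡⟨ +-∸-assoc 1 (toℕ<n (zigzag i)) ⟨
  n ∸ toℕ (zigzag i)              ≡⟨ cong (n ∸_) (zigzag-even k i (suc-injective e)) ⟩
  n ∸ k                           ∎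
  where open ≡-Reasoning

-- Dropping leading terms only reflects the rest, an isometry, so `i` may be moved to the start,
-- where the term is 0 and `zigzag-even` applies.
zigzag-distance : ∀ {n} k (i j : Fin n) → toℕ j ≡ toℕ i + k * 2 →
  ∣ toℕ (zigzag i) - toℕ (zigzag j) ∣ ≡ k
zigzag-distance k zero    j       e = zigzag-even k j e
zigzag-distance k (suc i) (suc j) e = trans
  (opposite-isometry (zigzag i) (zigzag j))
  (zigzag-distance k i j (suc-injective e))

-- Agreement with the alternating extreme assignment.

even⊎odd : ∀ m → (∃[ k ] m ≡ k * 2) ⊎ (∃[ k ] m ≡ suc (k * 2))
even⊎odd zero = inj₁ (0 , refl)
even⊎odd (suc m) with even⊎odd m
... | inj₁ (k , e) = inj₂ (k , cong suc e)
... | inj₂ (k , e) = inj₁ (suc k , cong suc e)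

2∤1+k*2 : ∀ k → 2 ∤ suc (k * 2)
2∤1+k*2 k d =
  >⇒∤ (s≤s (s≤s z≤n)) (∣m+n∣m⇒∣n (subst (2 ∣_) (+-comm 1 (k * 2)) d) (n∣m*n k))

alternatingExtreme-even : ∀ n k → alternatingExtreme n (k * 2) ≡ k
alternatingExtreme-even n k
  rewrite dec-true (2 ∣? k * 2) (n∣m*n k) = m*n/n≡m k 2

alternatingExtreme-odd : ∀ n k → alternatingExtreme n (suc (k * 2)) ≡ n ∸ 1 ∸ k
alternatingExtreme-odd n k
  rewrite dec-false (2 ∣? suc (k * 2)) (2∤1+k*2 k) = cong (n ∸ 1 ∸_) (m*n/n≡m k 2)

zigzag≡alternatingExtreme : ∀ {n} (i : Fin n) → toℕ (zigzag i) ≡ alternatingExtreme n (toℕ i)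
zigzag≡alternatingExtreme {n} i with even⊎odd (toℕ i)
... | inj₁ (k , e) = trans (zigzag-even k i e)
  (sym (trans (cong (alternatingExtreme n) e) (alternatingExtreme-even n k)))
... | inj₂ (k , e) = trans (zigzag-odd k i e)
  (sym (trans (cong (alternatingExtreme n) e) (alternatingExtreme-odd n k)))

-- Root-to-leaf paths in an arbitrary rooted tree.

module _ (T : RootedTree) where
  open RootedTree T

  -- A simple path from the root never turns upwards: the root has no parent, and going up right
  -- after a descent would revisit the vertex just left, by uniqueness of parents.
  path-descends : ∀ {d u} → IsRootToLeafPath T d u → (i : Fin d) → u (inject₁ i) ⟶ u (suc i)
  path-descends {suc d} {u} p = <-weakInduction (λ i → u (inject₁ i) ⟶ u (suc i)) first next
    where
    open IsRootToLeafPath p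

    first : u zero ⟶ u (suc zero)
    first with step zero
    ... | inj₁ down = down
    ... | inj₂ up   = contradiction (subst (u (suc zero) ⟶_) starts up) root-orphan

    2+i≢i : ∀ {m} (i : Fin m) → suc (suc i) ≢ inject₁ (inject₁ i)
    2+i≢i (suc i) e = 2+i≢i i (Finₚ.suc-injective e)

    next : ∀ i → u (inject₁ (inject₁ i)) ⟶ u (suc (inject₁ i)) →
           u (inject₁ (suc i)) ⟶ u (suc (suc i))
    next i down with step (suc i)
    ... | inj₁ down′ = down′
    ... | inj₂ up    = contradiction (distinct (parent-unique up down)) (2+i≢i i)

  -- This turns an upper bound on depth into an upper bound on the length of every root-to-leaf
  -- path.
  path-depth : (depth : V → ℕ) → depth root ≡ 0 →
    (∀ {x y} → x ⟶ y → depth y ≡ suc (depth x)) →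
    ∀ {d u} → IsRootToLeafPath T d u → ∀ i → depth (u i) ≡ toℕ i
  path-depth depth depth-root depth-child {u = u} p =
    <-weakInduction (λ i → depth (u i) ≡ toℕ i)
      (trans (cong depth (IsRootToLeafPath.starts p)) depth-root)
      (λ i e → trans (depth-child (path-descends p i))
                     (cong suc (trans e (toℕ-inject₁ i))))

-- Longest paths and the graceful labeling of the comb.

module _ (ℓ : ℕ) where
  open RootedTree (comb ℓ) using (V; finite)

  depth : V → ℕ
  depth (v i) = toℕ i
  depth (w i) = suc (toℕ i)

  depth-child : ∀ {x y} → CombChild x y → depth y ≡ suc (depth x)
  depth-child (spine i) = cong suc (sym (toℕ-inject₁ i))
  depth-child (tooth i) = cong suc (sym (toℕ-inject₁ i))

  depth≤ : ∀ x → depth x ≤ ℓ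
  depth≤ (v i) = toℕ≤pred[n] i
  depth≤ (w i) = toℕ<n i

  spine-longest : IsLongestRootToLeafPath (comb ℓ) ℓ v
  spine-longest = record
    { starts   = refl
    ; ends     = comb-leaf-v ℓ
    ; step     = λ i → inj₁ (spine i)
    ; distinct = λ { refl → refl }
    } , λ e u p → subst (_≤ ℓ)
      (trans (path-depth (comb ℓ) depth refl depth-child p (fromℕ e)) (toℕ-fromℕ e))
      (depth≤ (u (fromℕ e)))

  reverseTeeth : V → V
  reverseTeeth (v i) = v i
  reverseTeeth (w i) = w (opposite i)

  reverseTeeth-involutive : ∀ x → reverseTeeth (reverseTeeth x) ≡ x
  reverseTeeth-involutive (v i) = refl
  reverseTeeth-involutive (w i) = cong w (opposite-involutive i)

  -- finite enumerates v_0, …, v_ℓ, w_0, …, w_(ℓ-1), so reversing the teeth first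
  -- puts w_i at position 2ℓ - i.
  labeling-↔ : V ↔ Fin (suc ℓ + ℓ)
  labeling-↔ = zigzag-↔ ↔-∘ (finite ↔-∘
    mk↔ₛ′ reverseTeeth reverseTeeth reverseTeeth-involutive reverseTeeth-involutive)

  labeling : V → Fin (suc ℓ + ℓ)
  labeling = Inverse.to labeling-↔

  edgeLabel : V → V → ℕ
  edgeLabel x y = ∣ toℕ (labeling x) - toℕ (labeling y) ∣

  spine-label : ∀ i → edgeLabel (v (inject₁ i)) (v (suc i)) + toℕ i ≡ ℓ + ℓ
  spine-label i = subst₂
    (λ j t → ∣ toℕ (zigzag j) - toℕ (zigzag (suc (i ↑ˡ ℓ))) ∣ + t ≡ ℓ + ℓ)
    -- Only the parent needs transport along this equation: `suc i ↑ˡ ℓ` already computes to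
    -- `suc (i ↑ˡ ℓ)`.
    (toℕ-injective (begin
      toℕ (inject₁ (i ↑ˡ ℓ)) ≡⟨ toℕ-inject₁ (i ↑ˡ ℓ) ⟩
      toℕ (i ↑ˡ ℓ)           ≡⟨ toℕ-↑ˡ i ℓ ⟩
      toℕ i                  ≡⟨ toℕ-inject₁ i ⟨
      toℕ (inject₁ i)        ≡⟨ toℕ-↑ˡ (inject₁ i) ℓ ⟨
      toℕ (inject₁ i ↑ˡ ℓ)   ∎))
    (toℕ-↑ˡ i ℓ)
    (zigzag-step (i ↑ˡ ℓ))
    where open ≡-Reasoning

  tooth-label : ∀ i → edgeLabel (v (inject₁ i)) (w i) + toℕ i ≡ ℓ
  tooth-label i = begin
    -- Here `suc r` is ℓ - i, half the distance between the positions of the two endpoints.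
    edgeLabel (v (inject₁ i)) (w i) + t ≡⟨ cong (_+ t) (zigzag-distance (suc r) _ _ position) ⟩
    suc r + t                           ≡⟨ +-suc r t ⟨
    r + suc t                           ≡⟨ opposite-+ i ⟩
    ℓ                                   ∎
    where
    open ≡-Reasoning
    r = toℕ (opposite i)
    t = toℕ i

    arith : ∀ r t → suc (r + suc t) + r ≡ t + suc r * 2
    arith = solve-∀

    position : toℕ (Inverse.to finite (w (opposite i))) ≡
               toℕ (Inverse.to finite (v (inject₁ i))) + suc r * 2
    position = begin
      toℕ (Inverse.to finite (w (opposite i))) ≡⟨ toℕ-↑ʳ (suc ℓ) (opposite i) ⟩
      suc ℓ + r                                ≡⟨ cong (λ m → suc m + r) (opposite-+ i) ⟨
      suc (r + suc t) + r                      ≡⟨ arith r t ⟩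
      t + suc r * 2                            ≡⟨ cong (_+ suc r * 2) (trans (toℕ-↑ˡ (inject₁ i) ℓ) (toℕ-inject₁ i)) ⟨
      toℕ (Inverse.to finite (v (inject₁ i))) + suc r * 2 ∎

  graceful : IsGraceful (comb ℓ) labeling
  graceful = record
    { bijective   = Bijection.bijective (↔⇒⤖ labeling-↔)
    ; edge-labels = λ k → mk⇔
        (λ { (x , y , inj₁ c , refl) → child-bounds c
           ; (x , y , inj₂ c , refl) → subst (λ k → 1 ≤ k × k ≤ ℓ + ℓ)
               (∣-∣-comm (toℕ (labeling y)) (toℕ (labeling x))) (child-bounds c) })
        (λ { (1≤k , k≤2ℓ) → realised 1≤k k≤2ℓ })
    }
    where
    bounds : ∀ {k} t {m} → k + t ≡ m → t < m → 1 ≤ k × k ≤ m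
    bounds {k} t refl t<m = +-cancelʳ-≤ t 1 k t<m , m≤m+n k t

    child-bounds : ∀ {x y} → CombChild x y → 1 ≤ edgeLabel x y × edgeLabel x y ≤ ℓ + ℓ
    child-bounds (spine i) = bounds (toℕ i) (spine-label i) (m≤n⇒m≤n+o ℓ (toℕ<n i))
    child-bounds (tooth i) with bounds (toℕ i) (tooth-label i) (toℕ<n i)
    ... | lower , upper = lower , m≤n⇒m≤n+o ℓ upper

    -- Labels descending by one from m take the value k at index m - k, which is a valid index by
    -- the last hypothesis.
    solve-for : ∀ {k m} (label : Fin ℓ → ℕ) → (∀ i → label i + toℕ i ≡ m) →
                k ≤ m → m ∸ k < ℓ → ∃[ i ] label i ≡ k
    solve-for {k} {m} label eq k≤m lt = i , +-cancelʳ-≡ (toℕ i) (label i) k (begin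
      label i + toℕ i ≡⟨ eq i ⟩
      m               ≡⟨ m+[n∸m]≡n k≤m ⟨
      k + (m ∸ k)     ≡⟨ cong (k +_) (toℕ-fromℕ< lt) ⟨
      k + toℕ i       ∎)
      where
      open ≡-Reasoning
      i = fromℕ< lt

    realised : ∀ {k} → 1 ≤ k → k ≤ ℓ + ℓ →
               ∃₂ λ x y → Adjacent (comb ℓ) x y × edgeLabel x y ≡ k
    realised {k} 1≤k k≤2ℓ with k ≤? ℓ
    ... | yes k≤ℓ =
      let i , e = solve-for (λ i → edgeLabel (v (inject₁ i)) (w i)) tooth-label
                    -- `1≤k` is read as 0 < k, which gives ℓ - k < ℓ - 0.
                    k≤ℓ (∸-monoʳ-< 1≤k k≤ℓ)
      in v (inject₁ i) , w i , inj₁ (tooth i) , e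
    ... | no k≰ℓ =
      let i , e = solve-for (λ i → edgeLabel (v (inject₁ i)) (v (suc i))) spine-label
                    -- From ℓ < k follows 2ℓ - k < 2ℓ - ℓ = ℓ.
                    k≤2ℓ (subst (ℓ + ℓ ∸ k <_) (m+n∸m≡n ℓ ℓ) (∸-monoʳ-< (≰⇒> k≰ℓ) k≤2ℓ))
      in v (inject₁ i) , v (suc i) , inj₁ (spine i) , e

theorem2p4 : (ℓ : ℕ) → 1 ≤ ℓ →
    let open RootedTree (comb ℓ) renaming (order to n) in
    n ≡ 2 * ℓ + 1 ×
    (Σ[ f ∈ (V → Fin n) ]
    IsGraceful (comb ℓ) f ×
    (∃[ d ] Σ[ u ∈ (Fin (suc d) → V) ]
    IsLongestRootToLeafPath (comb ℓ) d u ×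
    (∀ (i : Fin (suc d)) → toℕ (f (u i)) ≡ alternatingExtreme n (toℕ i))))
theorem2p4 ℓ _ = order≡ ℓ , labeling ℓ , graceful ℓ , ℓ , v , spine-longest ℓ , λ i →
  -- `reverseTeeth` fixes the spine and `finite` sends `v i` to `i ↑ˡ ℓ`, so the label of `v i` is
  -- the zigzag term at position i.
  trans (zigzag≡alternatingExtreme (Inverse.to (RootedTree.finite (comb ℓ)) (v i)))
        (cong (alternatingExtreme (suc ℓ + ℓ)) (toℕ-↑ˡ i ℓ))
  where
  order≡ : ∀ ℓ → suc ℓ + ℓ ≡ 2 * ℓ + 1
  order≡ = solve-∀
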